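{- Let $1\le r\le n$ and let $p=(p_1,\dots,p_n)$ be a size vector. If $A,B\subseteq S_p$ form a maximal pair of $r$-cross-intersecting families, then each of $A$, $B$ determines the other; in particular $A$ and $B$ have the same set of relevant coordinates. Moreover, if $A$ is the Hamming ball of radius $l$ around $x_0\in S_p$ in a set of coordinates $T\subseteq[n]$, then $|T|\ge l+r$, $B$ is the Hamming ball of radius $|T|-l-r$ around $x_0$ in the coordinates $T$, $p_i\le p_j$ holds for every $i\in T$ and $j\in[n]\setminus T$, and $\big||T|-2l-r\big|\le 1$.
   Context: $[m]=\{1,\dots,m\}$. A size vector is a sequence of integers $p=(p_1,\dots,p_n)$ with $p_i\ge 2$ for all $i$; $S_p=[p_1]\times\cdots\times[p_n]$. Two vectors $x,y\in S_p$ are $r$-intersecting if $|\{i: x_i=y_i\}|\ge r$; families $A,B\subseteq S_p$ are $r$-cross-intersecting if every $x\in A$, $y\in B$ are $r$-intersecting. A pair $(A,B)$ of $r$-cross-intersecting families in $S_p$ is maximal if it maximizes $|A|\cdot|B|$ among all $r$-cross-intersecting pairs in $S_p$. A coordinate $i$ is irrelevant for $A\subseteq S_p$ if whenever two elements of $S_p$ differ only in coordinate $i$ and one lies in $A$, so does the other; otherwise $i$ is relevant for $A$. For $T\subseteq[n]$, $x_0\in S_p$ and $0\le k\le |T|$, the Hamming ball of radius $k$ around $x_0$ in the coordinates $T$ is $\{x\in S_p: |\{i\in T: x_i\ne (x_0)_i\}|\le k\}$. -}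

module Defs where

open import Data.Bool.Base using (Bool; true)
open import Data.Fin.Base using (Fin)
open import Data.Fin.Properties using (_≟_)
open import Data.Fin.Subset using (Subset; _∩_; ∁; ∣_∣)
open import Data.List.Base using (List; []; _∷_; allFin; cartesianProductWith; filterᵇ; length)
open import Data.Nat.Base using (ℕ; _≤_; _*_)
open import Data.Product.Base using (_×_)
open import Data.Vec.Base as Vec using (Vec; []; _∷_; tabulate)
open import Data.Vec.Membership.Propositional.Properties using (∈-lookup)
open import Data.Vec.Relation.Unary.All as All using (All; []; _∷_)
open import Function.Bundles using (_⇔_)
open import Relation.Binary.PropositionalEquality.Core using (_≡_; _≢_)
open import Relation.Nullary.Decidable.Core using (does)
open import Relation.Nullary.Negation.Core using (¬_)

private
  variable
    n : ℕ
    p : Vec ℕ n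

SizeVector : Vec ℕ n → Set
SizeVector p = All (2 ≤_) p

-- [p₁] × ⋯ × [pₙ] as heterogeneous vectors, with Fin m playing the role
-- of [m].
S : Vec ℕ n → Set
S p = All Fin p

infixl 9 _‼_

_‼_ : {p : Vec ℕ n} → S p → (i : Fin n) → Fin (Vec.lookup p i)
_‼_ {p = p} x i = All.lookup x (∈-lookup i p)

-- Every element of S p, listed exactly once.
elements : (p : Vec ℕ n) → List (S p)
elements []      = [] ∷ []
elements (m ∷ p) = cartesianProductWith _∷_ (allFin m) (elements p)

-- Families are the subsets of the finite set S p, given by their
-- characteristic functions; they are compared pointwise (_≗_).
Family : Vec ℕ n → Set
Family p = S p → Bool

infix 4 _∈ᶠ_

_∈ᶠ_ : S p → Family p → Set
x ∈ᶠ A = A x ≡ true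

size : Family p → ℕ
size {p = p} A = length (filterᵇ A (elements p))

agreements : {p : Vec ℕ n} → S p → S p → Subset n
agreements x y = tabulate λ i → does (x ‼ i ≟ y ‼ i)

Intersecting : ℕ → S p → S p → Set
Intersecting r x y = r ≤ ∣ agreements x y ∣

CrossIntersecting : ℕ → Family p → Family p → Set
CrossIntersecting r A B = ∀ x y → x ∈ᶠ A → y ∈ᶠ B → Intersecting r x y

MaximalPair : ℕ → Family p → Family p → Set
MaximalPair {p = p} r A B =
  CrossIntersecting r A B ×
  (∀ (A′ B′ : Family p) → CrossIntersecting r A′ B′ →
    size A′ * size B′ ≤ size A * size B)

-- The two elements are allowed to agree in coordinate i as well, in which
-- case they are equal and the condition is vacuous; ranging over both (x , y)
-- and (y , x) makes the one-sided implication symmetric.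
IrrelevantCoord : {p : Vec ℕ n} → Fin n → Family p → Set
IrrelevantCoord i A =
  ∀ x y → (∀ j → j ≢ i → x ‼ j ≡ y ‼ j) → x ∈ᶠ A → y ∈ᶠ A

RelevantCoord : {p : Vec ℕ n} → Fin n → Family p → Set
RelevantCoord i A = ¬ IrrelevantCoord i A

IsHammingBall : {p : Vec ℕ n} → Family p → ℕ → S p → Subset n → Set
IsHammingBall A k x₀ T =
  k ≤ ∣ T ∣ × (∀ x → x ∈ᶠ A ⇔ ∣ T ∩ ∁ (agreements x x₀) ∣ ≤ k)

{-# OPTIONS --safe #-}
module Submission where

-- A is recovered from B as the set of all vectors r-intersecting every member of B, since otherwise
-- it could be enlarged. If A is the ball of radius l in T, an adversary in A can destroy up to l
-- agreements with x₀ on T and all agreements off T, so B is the ball of radius m = |T| − l − r.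
-- Any set T′ and radii with l′ + m′ + r ≤ |T′| give a competing pair of balls: the sizes of balls are
-- strictly log-concave in the radius, which forces |l − m| ≤ 1, and exchanging i ∈ T for j ∉ T with
-- p j < p i makes both balls strictly larger.

open import Defs
open import Data.Bool.Base using (Bool; true; false; _∨_)
open import Data.Bool.Properties using (T-≡; ⇔→≡; ∨-zeroʳ)
open import Data.Fin.Base using (Fin; zero; suc)
open import Data.Fin.Properties using (_≟_)
open import Data.Fin.Subset using (Subset; inside; outside; ⊤; _∈_; _∉_; _⊆_; _∩_; ∁; ∣_∣)
open import Data.Fin.Subset.Properties using (∣⊤∣≡n; ∣p∣≡n⇒p≡⊤; ∣p∣≤n; ∈⊤; p⊆q⇒∣p∣≤∣q∣; x∈p∩q⁻; x∈p∩q⁺; p∩q⊆p; p∩q⊆q)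
open import Data.List.Base as List using (List; []; _∷_; _++_; allFin; cartesianProductWith; filterᵇ; length)
open import Data.List.Membership.Propositional using () renaming (_∈_ to _∈ˡ_)
open import Data.List.Membership.Propositional.Properties using (∈-allFin; ∈-cartesianProductWith⁺)
open import Data.List.Properties using (filter-++; length-++; map-tabulate)
open import Data.List.Relation.Unary.Any using (here; there)
open import Data.Nat.Base
open import Data.Nat.ListAction using (sum)
open import Data.Nat.Properties hiding (_≟_)
open import Data.Nat.Tactic.RingSolver using (solve-∀)
open import Data.Product.Base using (∃; _×_; _,_; proj₁; proj₂)
open import Data.Sum.Base using (inj₁; inj₂)
open import Data.Vec.Base as Vec using (Vec; []; _∷_; lookup; _[_]≔_)
open import Data.Vec.Properties using ([]=⇒lookup; lookup⇒[]=; []≔-lookup; []≔-commutes; lookup∘tabulate)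
open import Data.Vec.Relation.Unary.All using ([]; _∷_)
open import Function.Base using (_∘_; id)
open import Function.Bundles using (_⇔_; mk⇔; Equivalence)
open import Relation.Binary.PropositionalEquality using (_≡_; _≢_; _≗_; refl; sym; trans; cong; cong₂; subst; subst₂; module ≡-Reasoning)
open import Relation.Nullary.Decidable using (does; yes; no; dec-true; dec-false)
open import Relation.Nullary.Negation.Core using (contradiction)

private
  variable
    n r : ℕ
    p : Vec ℕ n

open Equivalence using (to; from)

-- Agreements and Hamming distance inside `T`.

∈-agreements : (x y : S p) (i : Fin n) → i ∈ agreements {p = p} x y ⇔ x ‼ i ≡ y ‼ i
∈-agreements x y i = mk⇔
  (λ i∈ → decide (trans (sym (lookup∘tabulate _ i)) ([]=⇒lookup i∈)))
  (λ eq → lookup⇒[]= i _ (trans (lookup∘tabulate _ i) (agree eq)))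
  where
  decide : does (x ‼ i ≟ y ‼ i) ≡ true → x ‼ i ≡ y ‼ i
  decide with x ‼ i ≟ y ‼ i
  ... | yes eq = λ _ → eq
  ... | no  _  = λ ()

  agree : x ‼ i ≡ y ‼ i → does (x ‼ i ≟ y ‼ i) ≡ true
  agree eq with x ‼ i ≟ y ‼ i
  ... | yes _  = refl
  ... | no neq = contradiction eq neq

agreements-⊆ : (x y x′ y′ : S p) → (∀ i → x ‼ i ≡ y ‼ i → x′ ‼ i ≡ y′ ‼ i) →
  agreements x y ⊆ agreements x′ y′
agreements-⊆ x y x′ y′ f {i} i∈ = from (∈-agreements x′ y′ i) (f i (to (∈-agreements x y i) i∈))

Intersecting-mono : (x y x′ y′ : S p) → (∀ i → x ‼ i ≡ y ‼ i → x′ ‼ i ≡ y′ ‼ i) →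
  Intersecting r x y → Intersecting r x′ y′
Intersecting-mono x y x′ y′ f r≤ = ≤-trans r≤ (p⊆q⇒∣p∣≤∣q∣ (agreements-⊆ x y x′ y′ f))

dist : Subset n → (x y : S {n} p) → ℕ
dist T x y = ∣ T ∩ ∁ (agreements x y) ∣

∣p∩q∣+∣p∩∁q∣≡∣p∣ : (P Q : Subset n) → ∣ P ∩ Q ∣ + ∣ P ∩ ∁ Q ∣ ≡ ∣ P ∣
∣p∩q∣+∣p∩∁q∣≡∣p∣ []            []            = refl
∣p∩q∣+∣p∩∁q∣≡∣p∣ (outside ∷ P) (_ ∷ Q)       = ∣p∩q∣+∣p∩∁q∣≡∣p∣ P Q
∣p∩q∣+∣p∩∁q∣≡∣p∣ (inside ∷ P)  (outside ∷ Q) =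
  trans (+-suc ∣ P ∩ Q ∣ _) (cong suc (∣p∩q∣+∣p∩∁q∣≡∣p∣ P Q))
∣p∩q∣+∣p∩∁q∣≡∣p∣ (inside ∷ P)  (inside ∷ Q)  = cong suc (∣p∩q∣+∣p∩∁q∣≡∣p∣ P Q)

-- Where `x` and `y` both agree with `z` they agree with each other; every other coordinate of `T`
-- is charged to one of the two distances.
∣T∣≤dist+dist+agreements : (T : Subset n) (x y z : S p) →
  ∣ T ∣ ≤ dist T x z + dist T y z + ∣ agreements x y ∣
∣T∣≤dist+dist+agreements T x y z = begin
  ∣ T ∣                                          ≡⟨ ∣p∩q∣+∣p∩∁q∣≡∣p∣ T P ⟨
  ∣ T ∩ P ∣ + dist T x z                         ≡⟨ +-comm ∣ T ∩ P ∣ _ ⟩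
  dist T x z + ∣ T ∩ P ∣                         ≡⟨ cong (dist T x z +_) (∣p∩q∣+∣p∩∁q∣≡∣p∣ (T ∩ P) Q) ⟨
  dist T x z + (∣ (T ∩ P) ∩ Q ∣ + ∣ (T ∩ P) ∩ ∁ Q ∣)
    ≤⟨ +-monoʳ-≤ (dist T x z) (+-mono-≤ (p⊆q⇒∣p∣≤∣q∣ common⊆R) (p⊆q⇒∣p∣≤∣q∣ rest⊆)) ⟩
  dist T x z + (∣ agreements x y ∣ + dist T y z) ≡⟨ cong (dist T x z +_) (+-comm _ (dist T y z)) ⟩
  dist T x z + (dist T y z + ∣ agreements x y ∣) ≡⟨ +-assoc (dist T x z) _ _ ⟨
  dist T x z + dist T y z + ∣ agreements x y ∣   ∎
  where
  open ≤-Reasoning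
  P = agreements x z
  Q = agreements y z
  common⊆R : (T ∩ P) ∩ Q ⊆ agreements x y
  common⊆R {i} i∈ with i∈T∩P , i∈Q ← x∈p∩q⁻ (T ∩ P) Q i∈ =
    from (∈-agreements x y i) (trans (to (∈-agreements x z i) (p∩q⊆q T P i∈T∩P))
                                     (sym (to (∈-agreements y z i) i∈Q)))
  rest⊆ : (T ∩ P) ∩ ∁ Q ⊆ T ∩ ∁ Q
  rest⊆ i∈ with i∈T∩P , i∈∁Q ← x∈p∩q⁻ (T ∩ P) (∁ Q) i∈ = x∈p∩q⁺ (p∩q⊆p T P i∈T∩P , i∈∁Q)

dist-self : (T : Subset n) (x : S p) → dist T x x ≡ 0
dist-self []            []      = refl
dist-self (outside ∷ T) (a ∷ x) = dist-self T x
dist-self (inside ∷ T)  (a ∷ x) rewrite dec-true (a ≟ a) refl = dist-self T x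

-- Construction of particular vectors.

another : ∀ {m} → 2 ≤ m → (a : Fin m) → ∃ λ b → b ≢ a
another (s≤s (s≤s _)) zero    = suc zero , λ ()
another (s≤s (s≤s _)) (suc _) = zero , λ ()

-- A centre for competing balls; any vector would do, as the size of a ball does not depend on its
-- centre.
point : SizeVector p → S p
point []                = []
point (s≤s _ ∷ 2≤p)     = zero ∷ point 2≤p

-- Chosen greedily, with `l` as a budget of departures from `z` on `T`. Off `T`, avoiding `y` is
-- free. On `T`, where `y` differs from `z`, copying `z` avoids `y` for free; where they coincide,
-- avoiding `y` costs one unit, and once the budget is spent an agreement is conceded.
adversary : SizeVector p → (T : Subset n) (z y : S p) (l : ℕ) → ∃ λ x →
  dist T x z ≤ l × ∣ agreements x y ∣ ≤ ∣ T ∩ agreements y z ∣ ∸ l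
adversary [] [] [] [] l = [] , z≤n , z≤n
adversary (2≤m ∷ 2≤p) (outside ∷ T) (c ∷ z) (b ∷ y) l
  with x , d≤ , a≤ ← adversary 2≤p T z y l | a , a≢b ← another 2≤m b =
  a ∷ x , d≤ , agrees
  where
  agrees : ∣ agreements (a ∷ x) (b ∷ y) ∣ ≤ ∣ T ∩ agreements y z ∣ ∸ l
  agrees rewrite dec-false (a ≟ b) a≢b = a≤
adversary (2≤m ∷ 2≤p) (inside ∷ T) (c ∷ z) (b ∷ y) l with b ≟ c
... | no b≢c with x , d≤ , a≤ ← adversary 2≤p T z y l
  = c ∷ x , close , agrees
  where
  close : dist (inside ∷ T) (c ∷ x) (c ∷ z) ≤ l
  close rewrite dec-true (c ≟ c) refl = d≤
  agrees : ∣ agreements (c ∷ x) (b ∷ y) ∣ ≤ ∣ T ∩ agreements y z ∣ ∸ l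
  agrees rewrite dec-false (c ≟ b) (b≢c ∘ sym) = a≤
adversary (2≤m ∷ 2≤p) (inside ∷ T) (c ∷ z) (c ∷ y) zero | yes refl
  with x , d≤ , a≤ ← adversary 2≤p T z y zero
  = c ∷ x , close , agrees
  where
  close : dist (inside ∷ T) (c ∷ x) (c ∷ z) ≤ 0
  close rewrite dec-true (c ≟ c) refl = d≤
  agrees : ∣ agreements (c ∷ x) (c ∷ y) ∣ ≤ suc ∣ T ∩ agreements y z ∣
  agrees rewrite dec-true (c ≟ c) refl = s≤s a≤
adversary (2≤m ∷ 2≤p) (inside ∷ T) (c ∷ z) (c ∷ y) (suc l) | yes refl
  with x , d≤ , a≤ ← adversary 2≤p T z y l | a , a≢c ← another 2≤m c
  = a ∷ x , close , agrees
  where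
  close : dist (inside ∷ T) (a ∷ x) (c ∷ z) ≤ suc l
  close rewrite dec-false (a ≟ c) a≢c = s≤s d≤
  agrees : ∣ agreements (a ∷ x) (c ∷ y) ∣ ≤ ∣ T ∩ agreements y z ∣ ∸ l
  agrees rewrite dec-false (a ≟ c) a≢c = a≤

update : (y : S p) (i : Fin n) (v : Fin (lookup p i)) → ∃ λ (y′ : S p) →
  y′ ‼ i ≡ v × (∀ j → j ≢ i → y′ ‼ j ≡ y ‼ j)
update (_ ∷ y) zero v = v ∷ y , refl , λ where
  zero    0≢0 → contradiction refl 0≢0
  (suc j) _   → refl
update (b ∷ y) (suc i) v with update y i v
... | y′ , eq , eqs = b ∷ y′ , eq , λ where
  zero    _   → refl
  (suc j) neq → eqs j (neq ∘ cong suc)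

-- Counting the members of a family.

module _ {X : Set} where

  length-filterᵇ-mono : {A B : X → Bool} → (∀ x → A x ≡ true → B x ≡ true) → ∀ xs →
    length (filterᵇ A xs) ≤ length (filterᵇ B xs)
  length-filterᵇ-mono A⊆B [] = z≤n
  length-filterᵇ-mono {A} {B} A⊆B (x ∷ xs) with A x in eqA | B x in eqB
  ... | true  | true  = s≤s (length-filterᵇ-mono A⊆B xs)
  ... | true  | false = contradiction (trans (sym eqB) (A⊆B x eqA)) λ ()
  ... | false | true  = m≤n⇒m≤1+n (length-filterᵇ-mono A⊆B xs)
  ... | false | false = length-filterᵇ-mono A⊆B xs

  length-filterᵇ-mono-< : {A B : X → Bool} → (∀ x → A x ≡ true → B x ≡ true) → ∀ {x xs} → x ∈ˡ xs →
    A x ≡ false → B x ≡ true → length (filterᵇ A xs) < length (filterᵇ B xs)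
  length-filterᵇ-mono-< A⊆B {xs = _ ∷ xs} (here refl) x∉A x∈B rewrite x∉A | x∈B =
    s≤s (length-filterᵇ-mono A⊆B xs)
  length-filterᵇ-mono-< {A} {B} A⊆B {xs = x ∷ xs} (there x∈) x∉A x∈B with A x in eqA | B x in eqB
  ... | true  | true  = s≤s (length-filterᵇ-mono-< A⊆B x∈ x∉A x∈B)
  ... | true  | false = contradiction (trans (sym eqB) (A⊆B x eqA)) λ ()
  ... | false | true  = m≤n⇒m≤1+n (length-filterᵇ-mono-< A⊆B x∈ x∉A x∈B)
  ... | false | false = length-filterᵇ-mono-< A⊆B x∈ x∉A x∈B

  length-filterᵇ-map : ∀ {Y : Set} (A : X → Bool) (f : Y → X) ys →
    length (filterᵇ A (List.map f ys)) ≡ length (filterᵇ (A ∘ f) ys)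
  length-filterᵇ-map A f []       = refl
  length-filterᵇ-map A f (y ∷ ys) with A (f y)
  ... | true  = cong suc (length-filterᵇ-map A f ys)
  ... | false = length-filterᵇ-map A f ys

  filterᵇ-inhabited : (A : X → Bool) → ∀ xs → 0 < length (filterᵇ A xs) → ∃ λ x → A x ≡ true
  filterᵇ-inhabited A (x ∷ xs) 0< with A x in x∈A
  ... | true  = x , x∈A
  ... | false = filterᵇ-inhabited A xs 0<

∈-elements : (x : S p) → x ∈ˡ elements p
∈-elements []      = here refl
∈-elements (a ∷ x) = ∈-cartesianProductWith⁺ _∷_ (∈-allFin a) (∈-elements x)

size-cong : {A B : Family p} → A ≗ B → size A ≡ size B
size-cong {p = p} A≗B = ≤-antisym
  (length-filterᵇ-mono (λ x → trans (sym (A≗B x))) (elements p))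
  (length-filterᵇ-mono (λ x → trans (A≗B x)) (elements p))

size-∷ : ∀ {m} (A : Family (m ∷ p)) → size A ≡ sum (List.tabulate λ a → size (A ∘ (a ∷_)))
size-∷ {p = p} {m} A = trans (go (allFin m)) (cong sum (map-tabulate {n = m} id (λ a → size (A ∘ (a ∷_)))))
  where
  go : ∀ as → length (filterᵇ A (cartesianProductWith _∷_ as (elements p))) ≡
    sum (List.map (λ a → size (A ∘ (a ∷_))) as)
  go []       = refl
  go (a ∷ as) = begin
    length (filterᵇ A (List.map (a ∷_) (elements p) ++ _))
      ≡⟨ cong length (filter-++ _ (List.map (a ∷_) (elements p)) _) ⟩
    length (filterᵇ A (List.map (a ∷_) (elements p)) ++ _)
      ≡⟨ length-++ (filterᵇ A (List.map (a ∷_) (elements p))) ⟩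
    length (filterᵇ A (List.map (a ∷_) (elements p))) + _
      ≡⟨ cong₂ _+_ (length-filterᵇ-map A (a ∷_) (elements p)) (go as) ⟩
    size (A ∘ (a ∷_)) + _ ∎
    where open ≡-Reasoning

sum-const : ∀ {m c} (f : Fin m → ℕ) → (∀ a → f a ≡ c) → sum (List.tabulate f) ≡ m * c
sum-const {zero}  f f≡c = refl
sum-const {suc m} f f≡c = cong₂ _+_ (f≡c zero) (sum-const (f ∘ suc) (f≡c ∘ suc))

sum-const-except : ∀ {m c d} (f : Fin m → ℕ) a → f a ≡ d → (∀ b → b ≢ a → f b ≡ c) →
  sum (List.tabulate f) ≡ d + (m ∸ 1) * c
sum-const-except f zero fa≡d f≡c = cong₂ _+_ fa≡d (sum-const (f ∘ suc) λ b → f≡c (suc b) λ ())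
sum-const-except {suc (suc m)} {c} {d} f (suc a) fa≡d f≡c = begin
  f zero + sum (List.tabulate (f ∘ suc))
    ≡⟨ cong₂ _+_ (f≡c zero λ ())
         (sum-const-except (f ∘ suc) a fa≡d λ b b≢a → f≡c (suc b) λ { refl → b≢a refl }) ⟩
  c + (d + m * c)  ≡⟨ exchange c d (m * c) ⟩
  d + (c + m * c)  ∎
  where
  open ≡-Reasoning
  exchange : ∀ x y z → x + (y + z) ≡ y + (x + z)
  exchange = solve-∀

-- Sizes of Hamming balls.

-- The effect of one more coordinate with `m` values on the sequence of ball sizes. Outside `T` its
-- value is free; inside, one value keeps the radius and the other `m ∸ 1` lower it by one. On
-- generating functions this is multiplication by m or by 1 + (m - 1)X.
grow : Bool → ℕ → (ℕ → ℕ) → ℕ → ℕ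
grow outside m g k       = m * g k
grow inside  m g zero    = g zero
grow inside  m g (suc k) = g (suc k) + (m ∸ 1) * g k

-- vol T p k counts the vectors at distance strictly less than k from a given one, that is, a ball of
-- radius k − 1. The shift makes the log-concavity below hold from index 0, where the ball is empty.
vol : Subset n → Vec ℕ n → ℕ → ℕ
vol []      []      zero    = 0
vol []      []      (suc k) = 1
vol (s ∷ T) (m ∷ p)         = grow s m (vol T p)

-- As in `vol`, the index is the radius plus one, so index 0 gives the empty family.
ball : Subset n → S {n} p → ℕ → Family p
ball T x₀ k x = dist T x x₀ <ᵇ k

∈-ball : (T : Subset n) (x₀ x : S p) (k : ℕ) → x ∈ᶠ ball T x₀ k ⇔ dist T x x₀ < k
∈-ball T x₀ x k = mk⇔ (<ᵇ⇒< _ k ∘ from T-≡) (to T-≡ ∘ <⇒<ᵇ)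

length-filterᵇ-none : ∀ {X : Set} (xs : List X) → length (filterᵇ (λ _ → false) xs) ≡ 0
length-filterᵇ-none []       = refl
length-filterᵇ-none (_ ∷ xs) = length-filterᵇ-none xs

vol-zero : (T : Subset n) (p : Vec ℕ n) → vol T p 0 ≡ 0
vol-zero []            []      = refl
vol-zero (outside ∷ T) (m ∷ p) = trans (cong (m *_) (vol-zero T p)) (*-zeroʳ m)
vol-zero (inside ∷ T)  (m ∷ p) = vol-zero T p

size-ball : (T : Subset n) (x₀ : S p) (k : ℕ) → size (ball T x₀ k) ≡ vol T p k
size-ball []            []       zero    = refl
size-ball []            []       (suc k) = refl
size-ball {p = m ∷ _} (outside ∷ T) (c ∷ x₀) k =
  trans (size-∷ (ball (outside ∷ T) (c ∷ x₀) k)) (sum-const {m} (λ _ → size (ball T x₀ k)) λ _ → size-ball T x₀ k)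
size-ball {p = m ∷ p} (inside ∷ T) (c ∷ x₀) zero    =
  trans (length-filterᵇ-none (elements (m ∷ p))) (sym (vol-zero T p))
size-ball {p = m ∷ p} (inside ∷ T) (c ∷ x₀) (suc k) =
  trans (size-∷ (ball (inside ∷ T) (c ∷ x₀) (suc k))) (sum-const-except _ c centre others)
  where
  centre : size (λ x → ball (inside ∷ T) (c ∷ x₀) (suc k) (c ∷ x)) ≡ vol T p (suc k)
  centre rewrite dec-true (c ≟ c) refl = size-ball T x₀ (suc k)
  others : ∀ a → a ≢ c → size (λ x → ball (inside ∷ T) (c ∷ x₀) (suc k) (a ∷ x)) ≡ vol T p k
  others a a≢c rewrite dec-false (a ≟ c) a≢c = size-ball T x₀ k

grow-cong : ∀ s {m} {g h : ℕ → ℕ} → g ≗ h → grow s m g ≗ grow s m h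
grow-cong outside {m} g≗h k       = cong (m *_) (g≗h k)
grow-cong inside  {m} g≗h zero    = g≗h zero
grow-cong inside  {m} g≗h (suc k) = cong₂ (λ u v → u + (m ∸ 1) * v) (g≗h (suc k)) (g≗h k)

grow-comm-outside-inside : ∀ m m′ (g : ℕ → ℕ) →
  grow outside m (grow inside m′ g) ≗ grow inside m′ (grow outside m g)
grow-comm-outside-inside m m′ g zero    = refl
grow-comm-outside-inside m m′ g (suc k) = distrib m (m′ ∸ 1) (g (suc k)) (g k)
  where
  distrib : ∀ x y u v → x * (u + y * v) ≡ x * u + y * (x * v)
  distrib = solve-∀

-- Both operators multiply the generating function by a polynomial, so they commute. Any coordinate
-- can thus be treated as the outermost one.
grow-comm : ∀ s t m m′ (g : ℕ → ℕ) → grow s m (grow t m′ g) ≗ grow t m′ (grow s m g)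
grow-comm outside outside m m′ g k = swap m m′ (g k)
  where
  swap : ∀ x y z → x * (y * z) ≡ y * (x * z)
  swap = solve-∀
grow-comm outside inside m m′ g k      = grow-comm-outside-inside m m′ g k
grow-comm inside outside m m′ g k      = sym (grow-comm-outside-inside m′ m g k)
grow-comm inside inside m m′ g zero    = refl
grow-comm inside inside m m′ g (suc zero) = swap (m ∸ 1) (m′ ∸ 1) (g 1) (g 0)
  where
  swap : ∀ x y u v → u + y * v + x * v ≡ u + x * v + y * v
  swap = solve-∀
grow-comm inside inside m m′ g (suc (suc k)) =
  swap (m ∸ 1) (m′ ∸ 1) (g (2 + k)) (g (1 + k)) (g k)
  where
  swap : ∀ x y u v w → u + y * v + x * (v + y * w) ≡ u + x * v + y * (v + x * w)
  swap = solve-∀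

vol-[]≔ : ∀ (T : Subset n) p i → ∃ λ h → ∀ s k →
  vol (T [ i ]≔ s) p k ≡ grow s (lookup p i) h k
vol-[]≔ (_ ∷ T) (m ∷ p) zero    = vol T p , λ _ _ → refl
vol-[]≔ (s′ ∷ T) (m ∷ p) (suc i) with h , eq ← vol-[]≔ T p i =
  grow s′ m h , λ s k → trans (grow-cong s′ (eq s) k) (grow-comm s′ s m _ h k)

-- The sequence `h` comes from the remaining coordinates and is fixed before `s` and `t`, so sets
-- that differ only at `i` and `j` can be compared through the same `h`.
vol-[]≔² : ∀ (T : Subset n) p i j → i ≢ j → ∃ λ h → ∀ s t k →
  vol ((T [ i ]≔ s) [ j ]≔ t) p k ≡ grow s (lookup p i) (grow t (lookup p j) h) k
vol-[]≔² T p zero zero 0≢0 = contradiction refl 0≢0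
vol-[]≔² (_ ∷ T) (m ∷ p) zero (suc j) _ with h , eq ← vol-[]≔ T p j =
  h , λ s t k → grow-cong s (eq t) k
vol-[]≔² (_ ∷ T) (m ∷ p) (suc i) zero _ with h , eq ← vol-[]≔ T p i =
  h , λ s t k → trans (grow-cong t (eq s) k) (grow-comm t s m _ h k)
vol-[]≔² (s′ ∷ T) (m ∷ p) (suc i) (suc j) i≢j
  with h , eq ← vol-[]≔² T p i j (i≢j ∘ cong suc) =
  grow s′ m h , λ s t k → trans (grow-cong s′ (eq s t) k)
    (trans (grow-comm s′ s m _ _ k) (grow-cong s (grow-comm s′ t m _ h) k))

-- Log-concavity of ball sizes.

-- The ratios g (k + 1) / g k decrease, cross-multiplied because g 0 = 0. Strictness stops at `t`,
-- the number of coordinates in `T`: from index t + 1 on, the ball is the whole space.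
record LogConcave (t : ℕ) (g : ℕ → ℕ) : Set where
  field
    at-zero : g 0 ≡ 0
    pos     : ∀ k → 0 < g (suc k)
    mono-≤  : ∀ k → g k ≤ g (suc k)
    mono-<  : ∀ {k} → k ≤ t → g k < g (suc k)
    lc-≤    : ∀ {a b} → a < b → g a * g (suc b) ≤ g (suc a) * g b
    lc-<    : ∀ {a b} → a < b → a ≤ t → g a * g (suc b) < g (suc a) * g b

open LogConcave

grow-outside-LogConcave : ∀ {t g m} → 2 ≤ m → LogConcave t g → LogConcave t (grow outside m g)
grow-outside-LogConcave {t} {g} {m@(suc _)} 2≤m L = record
  { at-zero = trans (cong (m *_) (at-zero L)) (*-zeroʳ m)
  ; pos     = λ k → *-mono-< {0} {m} {0} z<s (pos L k)
  ; mono-≤  = λ k → *-monoʳ-≤ m (mono-≤ L k)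
  ; mono-<  = λ k≤t → *-monoʳ-< m (mono-< L k≤t)
  ; lc-≤    = λ {a} {b} a<b → subst₂ _≤_ (sym (square m (g a) _)) (sym (square m (g (suc a)) _))
      (*-monoʳ-≤ (m * m) (lc-≤ L a<b))
  ; lc-<    = λ {a} {b} a<b a≤t → subst₂ _<_ (sym (square m (g a) _)) (sym (square m (g (suc a)) _))
      (*-monoʳ-< (m * m) (lc-< L a<b a≤t))
  }
  where
  square : ∀ m x y → (m * x) * (m * y) ≡ (m * m) * (x * y)
  square = solve-∀

-- With w = m - 1, both products expand into polynomials in w that are compared coefficient by
-- coefficient. The w² coefficients involve `g` one index lower; they supply strictness, which
-- therefore reaches one index further for the new sequence.
grow-inside-LogConcave : ∀ {t g m} → 2 ≤ m → LogConcave t g → LogConcave (suc t) (grow inside m g)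
grow-inside-LogConcave {t} {g} {suc w@(suc _)} (s≤s (s≤s _)) L = record
  { at-zero = at-zero L
  ; pos     = pos′
  ; mono-≤  = mono-≤′
  ; mono-<  = mono-<′
  ; lc-≤    = lc-≤′
  ; lc-<    = lc-<′
  }
  where
  g′ : ℕ → ℕ
  g′ = grow inside (suc w) g

  pos′ : ∀ k → 0 < g′ (suc k)
  pos′ k = <-≤-trans (pos L k) (m≤m+n _ _)

  mono-≤′ : ∀ k → g′ k ≤ g′ (suc k)
  mono-≤′ zero    = subst (_≤ g′ 1) (sym (at-zero L)) z≤n
  mono-≤′ (suc k) = +-mono-≤ (mono-≤ L (suc k)) (*-monoʳ-≤ w (mono-≤ L k))

  mono-<′ : ∀ {k} → k ≤ suc t → g′ k < g′ (suc k)
  mono-<′ {zero}  _         = subst (_< g′ 1) (sym (at-zero L)) (pos′ 0)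
  mono-<′ {suc k} (s≤s k≤t) = +-mono-≤-< (mono-≤ L (suc k)) (*-monoʳ-< w (mono-< L k≤t))

  lhs : ∀ w x y v s → (y + w * x) * (s + w * v) ≡ y * s + w * (x * s + y * v) + w * w * (x * v)
  lhs = solve-∀
  rhs : ∀ w y z u v → (z + w * y) * (v + w * u) ≡ z * v + w * (z * u + y * v) + w * w * (y * u)
  rhs = solve-∀

  -- The inequalities at (a, b) and (a + 1, b + 1) are multiplied and the common positive factor is
  -- cancelled.
  lc-two-steps : ∀ {a b} → a < b → g a * g (2 + b) ≤ g (2 + a) * g b
  lc-two-steps {a} {b} a<b = *-cancelʳ-≤ _ _ (g (1 + a) * g (1 + b))
    {{>-nonZero (*-mono-< (pos L a) (pos L b))}}
    (subst₂ _≤_ (shuffle₁ (g a) (g (1 + a)) (g (1 + b)) (g (2 + b)))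
                (shuffle₂ (g (1 + a)) (g (2 + a)) (g b) (g (1 + b)))
      (*-mono-≤ (lc-≤ L a<b) (lc-≤ L (s≤s a<b))))
    where
    shuffle₁ : ∀ x y v s → (x * v) * (y * s) ≡ (x * s) * (y * v)
    shuffle₁ = solve-∀
    shuffle₂ : ∀ y z u v → (y * u) * (z * v) ≡ (z * u) * (y * v)
    shuffle₂ = solve-∀

  lower-terms-≤ : ∀ {a b} → a < b →
    g (1 + a) * g (2 + b) + w * (g a * g (2 + b) + g (1 + a) * g (1 + b)) ≤
    g (2 + a) * g (1 + b) + w * (g (2 + a) * g b + g (1 + a) * g (1 + b))
  lower-terms-≤ a<b =
    +-mono-≤ (lc-≤ L (s≤s a<b)) (*-monoʳ-≤ w (+-monoˡ-≤ _ (lc-two-steps a<b)))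

  lc-≤′ : ∀ {a b} → a < b → g′ a * g′ (suc b) ≤ g′ (suc a) * g′ b
  lc-≤′ {zero}  {b}     _         = subst (λ x → x * g′ (suc b) ≤ g′ 1 * g′ b) (sym (at-zero L)) z≤n
  lc-≤′ {suc a} {suc b} (s≤s a<b) = subst₂ _≤_
    (sym (lhs w (g a) (g (1 + a)) (g (1 + b)) (g (2 + b))))
    (sym (rhs w (g (1 + a)) (g (2 + a)) (g b) (g (1 + b))))
    (+-mono-≤ (lower-terms-≤ a<b) (*-monoʳ-≤ (w * w) (lc-≤ L a<b)))

  lc-<′ : ∀ {a b} → a < b → a ≤ suc t → g′ a * g′ (suc b) < g′ (suc a) * g′ b
  lc-<′ {zero}  {suc b} _ _ = subst (λ x → x * g′ (2 + b) < g′ 1 * g′ (suc b)) (sym (at-zero L))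
    (*-mono-< (pos′ 0) (pos′ b))
  lc-<′ {suc a} {suc b} (s≤s a<b) (s≤s a≤t) = subst₂ _<_
    (sym (lhs w (g a) (g (1 + a)) (g (1 + b)) (g (2 + b))))
    (sym (rhs w (g (1 + a)) (g (2 + a)) (g b) (g (1 + b))))
    (+-mono-≤-< (lower-terms-≤ a<b) (*-monoʳ-< (w * w) (lc-< L a<b a≤t)))

-- The recursion starts from the sequence 0, 1, 1, ..., and each coordinate in `T` extends the
-- strict range by one.
vol-LogConcave : SizeVector p → (T : Subset n) → LogConcave ∣ T ∣ (vol T p)
vol-LogConcave [] [] = record
  { at-zero = refl
  ; pos     = λ _ → s≤s z≤n
  ; mono-≤  = λ { zero → z≤n ; (suc _) → ≤-refl }
  ; mono-<  = λ { z≤n → s≤s z≤n }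
  ; lc-≤    = λ { {zero} _ → z≤n ; {suc _} (s≤s (s≤s _)) → ≤-refl }
  ; lc-<    = λ { (s≤s _) z≤n → s≤s z≤n }
  }
vol-LogConcave (2≤m ∷ 2≤p) (outside ∷ T) = grow-outside-LogConcave 2≤m (vol-LogConcave 2≤p T)
vol-LogConcave (2≤m ∷ 2≤p) (inside ∷ T)  = grow-inside-LogConcave 2≤m (vol-LogConcave 2≤p T)

-- Exchanging a coordinate of `T` for one outside.

-- The two sides differ by exactly (a - b)(h (k + 1) - h k).
grow-exchange-< : ∀ {a b} (h : ℕ → ℕ) k → 0 < b → b < a → h k < h (suc k) →
  grow inside a (grow outside b h) (suc k) < grow outside a (grow inside b h) (suc k)
grow-exchange-< {a} {suc b} h k _ b<a hk< with c , refl ← m≤n⇒∃[o]m+o≡n b<a =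
  subst₂ _<_ (lhs b c (h k) (h (suc k))) (rhs b c (h k) (h (suc k)))
    (+-monoʳ-< (suc b * h (suc k) + (b + suc c) * b * h k + b * h k) (*-monoʳ-< (suc c) hk<))
  where
  lhs : ∀ b c x y → suc b * y + (b + suc c) * b * x + b * x + suc c * x ≡
    suc b * y + (suc b + c) * (suc b * x)
  lhs = solve-∀
  rhs : ∀ b c x y → suc b * y + (b + suc c) * b * x + b * x + suc c * y ≡
    (suc (suc b) + c) * (y + b * x)
  rhs = solve-∀

∣[]≔∣ : (T : Subset n) (i : Fin n) → ∣ T [ i ]≔ inside ∣ ≡ suc ∣ T [ i ]≔ outside ∣
∣[]≔∣ (_ ∷ T)       zero    = refl
∣[]≔∣ (outside ∷ T) (suc i) = ∣[]≔∣ T i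
∣[]≔∣ (inside ∷ T)  (suc i) = cong suc (∣[]≔∣ T i)

[]≔-inside : {T : Subset n} {i : Fin n} → i ∈ T → T [ i ]≔ inside ≡ T
[]≔-inside {T = T} {i} i∈T = subst (λ s → T [ i ]≔ s ≡ T) ([]=⇒lookup i∈T) ([]≔-lookup T i)

[]≔-outside : {T : Subset n} {i : Fin n} → i ∉ T → T [ i ]≔ outside ≡ T
[]≔-outside {T = T} {i} i∉T with lookup T i in eq | []≔-lookup T i
... | outside | ≡T = ≡T
... | inside  | _  = contradiction (lookup⇒[]= i T eq) i∉T

SizeVector-lookup : SizeVector p → ∀ i → 2 ≤ lookup p i
SizeVector-lookup (2≤m ∷ _)   zero    = 2≤m
SizeVector-lookup (_   ∷ 2≤p) (suc i) = SizeVector-lookup 2≤p i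

vol-exchange-< : ∀ {T : Subset n} {i j} → SizeVector p → i ∈ T → j ∉ T → lookup p j < lookup p i →
  ∃ λ T′ → ∣ T′ ∣ ≡ ∣ T ∣ × (∀ k → k < ∣ T ∣ → vol T p (suc k) < vol T′ p (suc k))
vol-exchange-< {p = p} {T} {i} {j} 2≤p i∈T j∉T pj<pi = T′ , trans ∣T′∣ (sym ∣T∣) , vol<
  where
  a = lookup p i
  b = lookup p j
  U  = (T [ i ]≔ outside) [ j ]≔ outside
  T′ = (T [ i ]≔ outside) [ j ]≔ inside

  i≢j : i ≢ j
  i≢j refl = j∉T i∈T

  T≡ : (T [ i ]≔ inside) [ j ]≔ outside ≡ T
  T≡ = trans (cong (_[ j ]≔ outside) ([]≔-inside i∈T)) ([]≔-outside j∉T)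

  ∣T′∣ : ∣ T′ ∣ ≡ suc ∣ U ∣
  ∣T′∣ = ∣[]≔∣ (T [ i ]≔ outside) j

  ∣T∣ : ∣ T ∣ ≡ suc ∣ U ∣
  ∣T∣ = begin
    ∣ T ∣                                    ≡⟨ cong ∣_∣ T≡ ⟨
    ∣ (T [ i ]≔ inside) [ j ]≔ outside ∣     ≡⟨ cong ∣_∣ ([]≔-commutes T i j i≢j) ⟩
    ∣ (T [ j ]≔ outside) [ i ]≔ inside ∣     ≡⟨ ∣[]≔∣ (T [ j ]≔ outside) i ⟩
    suc ∣ (T [ j ]≔ outside) [ i ]≔ outside ∣ ≡⟨ cong (suc ∘ ∣_∣) ([]≔-commutes T i j i≢j) ⟨
    suc ∣ U ∣                                ∎
    where open ≡-Reasoning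

  split = vol-[]≔² T p i j i≢j
  h     = proj₁ split
  vol≡  = proj₂ split

  -- With both coordinates outside, `vol U p` is `h` scaled by a · b, so its strict monotonicity
  -- descends to `h`.
  h< : ∀ k → k ≤ ∣ U ∣ → h k < h (suc k)
  h< k k≤ = *-cancelˡ-< b _ _ (*-cancelˡ-< a _ _ (subst₂ _<_
    (vol≡ outside outside k) (vol≡ outside outside (suc k)) (mono-< (vol-LogConcave 2≤p U) k≤)))

  vol< : ∀ k → k < ∣ T ∣ → vol T p (suc k) < vol T′ p (suc k)
  vol< k k<∣T∣ = subst₂ _<_
    (trans (sym (vol≡ inside outside (suc k))) (cong (λ V → vol V p (suc k)) T≡))
    (sym (vol≡ outside inside (suc k)))
    (grow-exchange-< h k (<-trans z<s (SizeVector-lookup 2≤p j)) pj<pi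
      (h< k (s≤s⁻¹ (subst (k <_) ∣T∣ k<∣T∣))))

-- Maximal pairs in general.

CrossIntersecting-sym : {A B : Family p} → CrossIntersecting r A B → CrossIntersecting r B A
CrossIntersecting-sym cross y x y∈B x∈A =
  Intersecting-mono x y y x (λ _ → sym) (cross x y x∈A y∈B)

MaximalPair-sym : {A B : Family p} → MaximalPair r A B → MaximalPair r B A
MaximalPair-sym {A = A} {B} (cross , maximal) = CrossIntersecting-sym cross , λ A′ B′ cross′ →
  subst₂ _≤_ (*-comm (size B′) (size A′)) (*-comm (size A) (size B))
    (maximal B′ A′ (CrossIntersecting-sym cross′))

ball-CrossIntersecting : ∀ {r l m} (T : Subset n) (x₀ : S p) → l + m + r ≤ ∣ T ∣ →
  CrossIntersecting r (ball T x₀ (suc l)) (ball T x₀ (suc m))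
ball-CrossIntersecting {r = r} {l} {m} T x₀ l+m+r≤∣T∣ x y x∈ y∈ = +-cancelˡ-≤ (l + m) _ _ (begin
  l + m + r                                        ≤⟨ l+m+r≤∣T∣ ⟩
  ∣ T ∣                                            ≤⟨ ∣T∣≤dist+dist+agreements T x y x₀ ⟩
  dist T x x₀ + dist T y x₀ + ∣ agreements x y ∣   ≤⟨ +-monoˡ-≤ _ (+-mono-≤
    (s≤s⁻¹ (to (∈-ball T x₀ x (suc l)) x∈)) (s≤s⁻¹ (to (∈-ball T x₀ y (suc m)) y∈))) ⟩
  l + m + ∣ agreements x y ∣                       ∎)
  where open ≤-Reasoning

-- Turns maximality into numerical inequalities, one for each competing pair of concentric balls.
vol-bound : ∀ {r l m} {A B : Family p} → SizeVector p → MaximalPair r A B → (T : Subset n) →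
  l + m + r ≤ ∣ T ∣ → vol T p (suc l) * vol T p (suc m) ≤ size A * size B
vol-bound {l = l} {m} {A} {B} 2≤p (_ , maximal) T l+m+r≤∣T∣ = subst (_≤ size A * size B)
  (cong₂ _*_ (size-ball T (point 2≤p) (suc l)) (size-ball T (point 2≤p) (suc m)))
  (maximal _ _ (ball-CrossIntersecting T (point 2≤p) l+m+r≤∣T∣))

maximal-pos : {A B : Family {n} p} → r ≤ n → SizeVector p → MaximalPair r A B → 0 < size A * size B
-- The competitor has radii 0 on all coordinates: one vector, serving as both families.
maximal-pos {n = n} r≤n 2≤p M = <-≤-trans (*-mono-< (positive 0) (positive 0))
  (vol-bound {l = 0} {0} 2≤p M ⊤ (subst (_ ≤_) (sym (∣⊤∣≡n n)) r≤n))
  where positive = pos (vol-LogConcave 2≤p ⊤)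

size-pos : {A B : Family {n} p} → r ≤ n → SizeVector p → MaximalPair r A B → 0 < size A
size-pos {A = A} {B} r≤n 2≤p M = >-nonZero⁻¹ _ {{m*n≢0⇒m≢0 (size A) {{>-nonZero (maximal-pos r≤n 2≤p M)}}}}

-- The union of `B` and `B′` still cross-intersects `A`; a new member would enlarge the product
-- strictly, since `A` is nonempty.
maximal-absorbs : {A B : Family {n} p} → r ≤ n → SizeVector p → MaximalPair r A B →
  ∀ B′ → CrossIntersecting r A B′ → ∀ y → y ∈ᶠ B′ → y ∈ᶠ B
maximal-absorbs {p = p} {r = r} {A} {B} r≤n 2≤p M@(cross , maximal) B′ cross′ y y∈B′ with B y in y∉B
... | true  = refl
... | false = contradiction (maximal A B∪B′ cross∪)
    (<⇒≱ (*-monoʳ-< (size A) {{>-nonZero (size-pos r≤n 2≤p M)}} size<))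
  where
  B∪B′ : Family p
  B∪B′ z = B z ∨ B′ z

  cross∪ : CrossIntersecting r A B∪B′
  cross∪ x z x∈A z∈∪ with B z in z∈B
  ... | true  = cross x z x∈A z∈B
  ... | false = cross′ x z x∈A z∈∪

  size< : size B < size B∪B′
  size< = length-filterᵇ-mono-< (λ z z∈B → cong (_∨ B′ z) z∈B) (∈-elements y) y∉B
    (trans (cong (B y ∨_) y∈B′) (∨-zeroʳ (B y)))

-- Absorption is applied to the singleton of `y`, written as the ball of radius 0 in all
-- coordinates.
maximal-closed : {A B : Family {n} p} → r ≤ n → SizeVector p → MaximalPair r A B →
  ∀ y → (∀ x → x ∈ᶠ A → Intersecting r x y) → y ∈ᶠ B
maximal-closed {n = n} {p} {r} {A} r≤n 2≤p M y all = maximal-absorbs r≤n 2≤p M (ball ⊤ y 1) cross y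
  (from (∈-ball ⊤ y y 1) (s≤s (≤-reflexive (dist-self ⊤ y))))
  where
  agree : ∀ z → z ∈ᶠ ball ⊤ y 1 → ∀ i → z ‼ i ≡ y ‼ i
  agree z z∈ i = to (∈-agreements z y i) (subst (i ∈_) (sym agreements≡⊤) ∈⊤)
    where
    open ≤-Reasoning
    agreements≡⊤ : agreements z y ≡ ⊤
    agreements≡⊤ = ∣p∣≡n⇒p≡⊤ (≤-antisym (∣p∣≤n (agreements z y)) (begin
      n                                               ≡⟨ ∣⊤∣≡n n ⟨
      ∣ ⊤ {n} ∣                                       ≤⟨ ∣T∣≤dist+dist+agreements ⊤ z y y ⟩
      dist ⊤ z y + dist ⊤ y y + ∣ agreements z y ∣    ≡⟨ cong₂ (λ u v → u + v + ∣ agreements z y ∣)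
        (n<1⇒n≡0 (to (∈-ball ⊤ y z 1) z∈)) (dist-self ⊤ y) ⟩
      ∣ agreements z y ∣                              ∎))

  cross : CrossIntersecting r A (ball ⊤ y 1)
  cross x z x∈A z∈ = Intersecting-mono x y x z (λ i x≡y → trans x≡y (sym (agree z z∈ i))) (all x x∈A)

maximal-unique : {A B B′ : Family {n} p} → r ≤ n → SizeVector p →
  MaximalPair r A B → MaximalPair r A B′ → B′ ≗ B
maximal-unique r≤n 2≤p M M′ y = ⇔→≡ (mk⇔
  (maximal-absorbs r≤n 2≤p M _ (proj₁ M′) y)
  (maximal-absorbs r≤n 2≤p M′ _ (proj₁ M) y))

-- To see that x′ meets y, apply the hypothesis to y with its i-th entry changed to differ from x.
IrrelevantCoord-transfer : ∀ {i} {A B : Family {n} p} → r ≤ n → SizeVector p →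
  MaximalPair r A B → IrrelevantCoord i B → IrrelevantCoord i A
IrrelevantCoord-transfer {r = r} {i} {A} {B} r≤n 2≤p M irrelevant x x′ x≡x′ x∈A =
  maximal-closed r≤n 2≤p (MaximalPair-sym M) x′ meets
  where
  meets : ∀ y → y ∈ᶠ B → Intersecting r y x′
  meets y y∈B with v , v≢x ← another (SizeVector-lookup 2≤p i) (x ‼ i)
    with y′ , y′i≡v , y′≡y ← update y i v =
    Intersecting-mono x y′ y x′ agree
      (proj₁ M x y′ x∈A (irrelevant y y′ (λ j j≢i → sym (y′≡y j j≢i)) y∈B))
    where
    agree : ∀ j → x ‼ j ≡ y′ ‼ j → y ‼ j ≡ x′ ‼ j
    agree j xj≡y′j with j ≟ i
    ... | yes refl = contradiction (sym (trans xj≡y′j y′i≡v)) v≢x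
    ... | no  j≢i  = trans (sym (y′≡y j j≢i)) (trans (sym xj≡y′j) (x≡x′ j j≢i))

-- A gap of two could be narrowed to l + 1 and m − 1, increasing the product by log-concavity.
radii-balanced : ∀ {r l m N} → SizeVector p → (T : Subset n) →
  (∀ l′ m′ → l′ + m′ + r ≤ ∣ T ∣ → vol T p (suc l′) * vol T p (suc m′) ≤ N) →
  l + m + r ≤ ∣ T ∣ → N ≤ vol T p (suc l) * vol T p (suc m) → m ≤ suc l
radii-balanced {r = r} {l} {zero}  2≤p T bound l+m+r≤∣T∣ N≤ = z≤n
radii-balanced {r = r} {l} {suc m} 2≤p T bound l+m+r≤∣T∣ N≤ with m ≤? l
... | yes m≤l = s≤s m≤l
... | no  m≰l = contradiction
    (≤-trans (bound (suc l) m (subst (λ u → u + r ≤ ∣ T ∣) (+-suc l m) l+m+r≤∣T∣)) N≤)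
    (<⇒≱ (lc-< (vol-LogConcave 2≤p T) (s≤s (≰⇒> m≰l)) l<∣T∣))
  where
  l<∣T∣ : l < ∣ T ∣
  l<∣T∣ = ≤-trans (≤-trans (s≤s (m≤m+n l m)) (≤-reflexive (sym (+-suc l m))))
                  (m+n≤o⇒m≤o (l + suc m) l+m+r≤∣T∣)

-- Maximal pairs whose first family is a ball.

module _ {r l} {p : Vec ℕ n} (1≤r : 1 ≤ r) (r≤n : r ≤ n) (2≤p : SizeVector p) {A B : Family p}
  (M : MaximalPair r A B) (x₀ : S p) (T : Subset n)
  (A-ball : ∀ x → x ∈ᶠ A ⇔ dist T x x₀ ≤ l) where

  private
    m : ℕ
    m = ∣ T ∣ ∸ l ∸ r

  -- The adversary against `y` lies in `A`, so it still has to agree with `y` in `r` places.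
  ∈B⇒bound : ∀ y → y ∈ᶠ B → l + r + dist T y x₀ ≤ ∣ T ∣
  ∈B⇒bound y y∈B with x , d≤ , a≤ ← adversary 2≤p T x₀ y l = begin
    l + r + dist T y x₀                         ≡⟨ cong (_+ dist T y x₀) (+-comm l r) ⟩
    r + l + dist T y x₀                         ≤⟨ +-monoˡ-≤ _ (m≤o∸n⇒m+n≤o r l≤ r≤) ⟩
    ∣ T ∩ agreements y x₀ ∣ + dist T y x₀       ≡⟨ ∣p∩q∣+∣p∩∁q∣≡∣p∣ T (agreements y x₀) ⟩
    ∣ T ∣                                       ∎
    where
    open ≤-Reasoning
    r≤ : r ≤ ∣ T ∩ agreements y x₀ ∣ ∸ l
    r≤ = ≤-trans (proj₁ M x y (from (A-ball x) d≤) y∈B) a≤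
    -- Since r ≥ 1, the truncated difference in `r≤` is positive, hence a genuine difference.
    l≤ : l ≤ ∣ T ∩ agreements y x₀ ∣
    l≤ = <⇒≤ (m∸n≢0⇒n<m (n>0⇒n≢0 (≤-trans 1≤r r≤)))

  l+r≤∣T∣ : l + r ≤ ∣ T ∣
  l+r≤∣T∣ with y , y∈B ← filterᵇ-inhabited B (elements p) (size-pos r≤n 2≤p (MaximalPair-sym M)) =
    ≤-trans (m≤m+n _ _) (∈B⇒bound y y∈B)

  l+m+r≡∣T∣ : l + m + r ≡ ∣ T ∣
  l+m+r≡∣T∣ = begin
    l + m + r               ≡⟨ +-assoc l m r ⟩
    l + (m + r)             ≡⟨ cong (l +_) (m∸n+n≡m (m+n≤o⇒m≤o∸n r (subst (_≤ ∣ T ∣) (+-comm l r) l+r≤∣T∣))) ⟩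
    l + (∣ T ∣ ∸ l)         ≡⟨ m+[n∸m]≡n (m+n≤o⇒m≤o l l+r≤∣T∣) ⟩
    ∣ T ∣                   ∎
    where open ≡-Reasoning

  A≗ball : A ≗ ball T x₀ (suc l)
  A≗ball x = ⇔→≡ (mk⇔ (from (∈-ball T x₀ x (suc l)) ∘ s≤s ∘ to (A-ball x))
                      (from (A-ball x) ∘ s≤s⁻¹ ∘ to (∈-ball T x₀ x (suc l))))

  -- The adversary bounds the distance of members of `B`; conversely, the ball of radius `m`
  -- cross-intersects `A` and is absorbed.
  B-ball : ∀ y → y ∈ᶠ B ⇔ dist T y x₀ ≤ m
  B-ball y = mk⇔
    (λ y∈B → subst (dist T y x₀ ≤_) (sym (∸-+-assoc ∣ T ∣ l r))
       (m+n≤o⇒m≤o∸n (dist T y x₀) (subst (_≤ ∣ T ∣) (+-comm (l + r) _) (∈B⇒bound y y∈B))))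
    (λ d≤m → maximal-absorbs r≤n 2≤p M (ball T x₀ (suc m)) cross y
       (from (∈-ball T x₀ y (suc m)) (s≤s d≤m)))
    where
    cross : CrossIntersecting r A (ball T x₀ (suc m))
    cross x z x∈A = ball-CrossIntersecting {l = l} {m} T x₀ (≤-reflexive l+m+r≡∣T∣) x z
      (trans (sym (A≗ball x)) x∈A)

  B≗ball : B ≗ ball T x₀ (suc m)
  B≗ball y = ⇔→≡ (mk⇔ (from (∈-ball T x₀ y (suc m)) ∘ s≤s ∘ to (B-ball y))
                      (from (B-ball y) ∘ s≤s⁻¹ ∘ to (∈-ball T x₀ y (suc m))))

  size-product : size A * size B ≡ vol T p (suc l) * vol T p (suc m)
  size-product = cong₂ _*_
    (trans (size-cong A≗ball) (size-ball T x₀ (suc l)))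
    (trans (size-cong B≗ball) (size-ball T x₀ (suc m)))

  -- Otherwise an exchange keeps the size of `T`, so the same radii remain admissible, yet enlarges
  -- both balls. Strictness needs both radii below the size of `T`, which r ≥ 1 provides.
  T-minimizes : ∀ i j → i ∈ T → j ∉ T → lookup p i ≤ lookup p j
  T-minimizes i j i∈T j∉T with lookup p i ≤? lookup p j
  ... | yes pi≤pj = pi≤pj
  ... | no  pi≰pj with T′ , ∣T′∣≡∣T∣ , vol< ← vol-exchange-< 2≤p i∈T j∉T (≰⇒> pi≰pj) = contradiction
    (vol-bound {l = l} {m} 2≤p M T′ (≤-reflexive (trans l+m+r≡∣T∣ (sym ∣T′∣≡∣T∣))))
    (<⇒≱ (subst (_< vol T′ p (suc l) * vol T′ p (suc m)) (sym size-product) (*-mono-< (vol< l l<∣T∣) (vol< m m<∣T∣))))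
    where
    l+m<∣T∣ : l + m < ∣ T ∣
    l+m<∣T∣ = subst (l + m <_) l+m+r≡∣T∣ (m<m+n (l + m) 1≤r)
    l<∣T∣ : l < ∣ T ∣
    l<∣T∣ = ≤-<-trans (m≤m+n l m) l+m<∣T∣
    m<∣T∣ : m < ∣ T ∣
    m<∣T∣ = ≤-<-trans (m≤n+m m l) l+m<∣T∣

  ∣T∣-balanced : ∣ ∣ T ∣ - (2 * l + r) ∣ ≤ 1
  ∣T∣-balanced = subst (_≤ 1) (sym distance) (≤1 m≤1+l l≤1+m)
    where
    bound : ∀ l′ m′ → l′ + m′ + r ≤ ∣ T ∣ → vol T p (suc l′) * vol T p (suc m′) ≤ size A * size B
    bound l′ m′ = vol-bound {l = l′} {m′} 2≤p M T

    m≤1+l : m ≤ suc l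
    m≤1+l = radii-balanced 2≤p T bound (≤-reflexive l+m+r≡∣T∣) (≤-reflexive size-product)

    -- The same argument with the two radii interchanged.
    l≤1+m : l ≤ suc m
    l≤1+m = radii-balanced 2≤p T bound
      (≤-reflexive (trans (cong (_+ r) (+-comm m l)) l+m+r≡∣T∣))
      (≤-reflexive (trans size-product (*-comm (vol T p (suc l)) _)))

    shift : ∀ l r m → l + m + r ≡ l + r + m
    shift = solve-∀
    double : ∀ l r → 2 * l + r ≡ l + r + l
    double = solve-∀

    -- As the size of `T` is l + m + r, the quantity to bound is just the gap between the radii.
    distance : ∣ ∣ T ∣ - (2 * l + r) ∣ ≡ ∣ m - l ∣
    distance = trans
      (cong₂ ∣_-_∣ (trans (sym l+m+r≡∣T∣) (shift l r m)) (double l r))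
      (∣m+n-m+o∣≡∣n-o∣ (l + r) m l)

    ≤1 : ∀ {u v} → u ≤ suc v → v ≤ suc u → ∣ u - v ∣ ≤ 1
    ≤1 {u} {v} u≤ v≤ with ∣m-n∣≡[m∸n]∨[n∸m] u v
    ... | inj₁ eq = subst (_≤ 1) (sym eq) (m≤n+o⇒m∸n≤o u v (subst (u ≤_) (+-comm 1 v) u≤))
    ... | inj₂ eq = subst (_≤ 1) (sym eq) (m≤n+o⇒m∸n≤o v u (subst (v ≤_) (+-comm 1 u) v≤))

theorem4 : ∀ (n r : ℕ) → 1 ≤ r → r ≤ n →
    (p : Vec ℕ n) → SizeVector p →
    (A B : Family p) → MaximalPair r A B →
    (∀ B′ → MaximalPair r A B′ → B′ ≗ B) ×
    (∀ A′ → MaximalPair r A′ B → A′ ≗ A) ×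
    (∀ i → RelevantCoord i A ⇔ RelevantCoord i B) ×
    (∀ (l : ℕ) (x₀ : S p) (T : Subset n) → IsHammingBall A l x₀ T →
    l + r ≤ ∣ T ∣ ×
    IsHammingBall B (∣ T ∣ ∸ l ∸ r) x₀ T ×
    (∀ i j → i ∈ T → j ∉ T → lookup p i ≤ lookup p j) ×
    ∣ ∣ T ∣ - (2 * l + r) ∣ ≤ 1)
theorem4 n r 1≤r r≤n p 2≤p A B M =
  (λ _ → maximal-unique r≤n 2≤p M) ,
  (λ _ → maximal-unique r≤n 2≤p (MaximalPair-sym M) ∘ MaximalPair-sym) ,
  -- Relevance is a negation, so carrying irrelevance from `B` to `A` carries relevance from `A` to
  -- `B`.
  (λ i → mk⇔ (_∘ IrrelevantCoord-transfer r≤n 2≤p M)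
             (_∘ IrrelevantCoord-transfer r≤n 2≤p (MaximalPair-sym M))) ,
  λ l x₀ T (_ , A-ball) →
    l+r≤∣T∣ 1≤r r≤n 2≤p M x₀ T A-ball ,
    (≤-trans (m∸n≤m (∣ T ∣ ∸ l) r) (m∸n≤m ∣ T ∣ l) , B-ball 1≤r r≤n 2≤p M x₀ T A-ball) ,
    T-minimizes 1≤r r≤n 2≤p M x₀ T A-ball ,
    ∣T∣-balanced 1≤r r≤n 2≤p M x₀ T A-ball
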